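{- Let $G$ be a simple, undirected, connected graph on $N>2$ vertices with edge set $E$ and degree sequence $d_1\le d_2\le\cdots\le d_N$. Then $$R^+(G)\ge N(N-2)+2|E|\sum_{j=1}^N\frac{1}{d_j}-\frac{4|E|}{1+d_1}.$$
   Context: For vertices $i,j$ of $G$, $R_{ij}$ denotes the effective resistance between $i$ and $j$ when every edge of $G$ is a unit resistor. The additive degree-Kirchhoff index is $R^+(G)=\sum_{i<j}(d_i+d_j)R_{ij}$, where $d_i$ is the degree of vertex $i$. -}

module Defs where

open import Algebra.Bundles using (CommutativeRing)
open import Data.Bool.Base using (if_then_else_)
open import Data.Fin.Base as Fin using (Fin; zero; suc)
open import Data.Fin.Permutation using (Permutation′; _⟨$⟩ʳ_)
open import Data.Fin.Properties as Fin using (any?)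
import Data.Integer.Base as ℤ
open import Data.Nat.Base as ℕ using (ℕ; zero; suc)
import Data.Nat.Properties as ℕ
open import Data.Product.Base using (∃; _×_; _,_; proj₁; proj₂)
open import Data.Rational.Base
open import Data.Rational.Properties
open import Data.Rational.Solver using (module +-*-Solver)
open import Data.Sum.Base using (_⊎_; inj₁; inj₂)
open import Function.Base using (_∘_)
open import Level using (0ℓ)
open import Relation.Binary.Construct.Closure.ReflexiveTransitive using (Star; ε; _◅_)
open import Relation.Binary.Core using (Rel)
open import Relation.Binary.Definitions using (Decidable; Irreflexive; Symmetric)
open import Relation.Binary.PropositionalEquality
open import Relation.Nullary.Decidable using (Dec; does; yes; no; _×-dec_; ¬?; decidable-stable)
open import Relation.Nullary.Negation using (contradiction)

open import Algebra.Properties.Semiring.Sum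
  (CommutativeRing.semiring +-*-commutativeRing) public
open import Algebra.Properties.Semiring.Sum ℕ.+-*-semiring public
  using () renaming (sum to sumℕ)

fromℕ : ℕ → ℚ
fromℕ n = ℤ.+ n / 1

-- The value at 0 is a dummy: in a connected graph with at least two vertices
-- every degree is positive.
recip : ℕ → ℚ
recip zero      = 0ℚ
recip n@(suc _) = ℤ.+ 1 / n

record Graph (N : ℕ) : Set₁ where
  infix 4 _~_ _~?_
  field
    _~_    : Rel (Fin N) 0ℓ
    _~?_   : Decidable _~_
    sym-~  : Symmetric _~_
    irrefl : Irreflexive _≡_ _~_

Connected : ∀ {N} → Graph N → Set
Connected G = ∀ i j → Star (Graph._~_ G) i j

indicator : ∀ {p} {P : Set p} → Dec P → ℕ
indicator p = if does p then 1 else 0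

degree : ∀ {N} → Graph N → Fin N → ℕ
degree G i = sumℕ λ j → indicator (i ~? j)
  where open Graph G

edgeCount : ∀ {N} → Graph N → ℕ
edgeCount G = sumℕ λ i → sumℕ λ j → indicator (i Fin.<? j ×-dec i ~? j)
  where open Graph G

IsDegreeSequence : ∀ {N} → Graph N → (Fin N → ℕ) → Set
IsDegreeSequence {N} G d =
  (∀ {i j} → i Fin.≤ j → d i ℕ.≤ d j) ×
  ∃ λ (π : Permutation′ N) → ∀ k → d k ≡ degree G (π ⟨$⟩ʳ k)

δ : ∀ {n} → Fin n → Fin n → ℚ
δ i j = if does (i Fin.≟ j) then 1ℚ else 0ℚ

-- By Ohm's law the current from k to an adjacent l is v k - v l, each edge
-- having unit resistance.
outflow : ∀ {N} → Graph N → (Fin N → ℚ) → Fin N → ℚ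
outflow {N} G v k = ∑[ l < N ] (if does (k ~? l) then v k - v l else 0ℚ)
  where open Graph G

-- Kirchhoff's current law for a unit current entering at s and leaving at t.
IsPotential : ∀ {N} → Graph N → Fin N → Fin N → (Fin N → ℚ) → Set
IsPotential G s t v = ∀ k → outflow G v k ≡ δ s k - δ t k

module _ where
  open +-*-Solver
  open ≡-Reasoning

  ∑-δ : ∀ {n} (k : Fin n) (f : Fin n → ℚ) → ∑[ l < n ] (δ k l * f l) ≡ f k
  ∑-δ {suc n} zero f = begin
    1ℚ * f zero + ∑[ l < n ] (0ℚ * f (suc l))
      ≡⟨ cong₂ _+_ (*-identityˡ (f zero)) (sum-cong-≗ {n} λ l → *-zeroˡ (f (suc l))) ⟩
    f zero + ∑[ l < n ] 0ℚ  ≡⟨ cong (f zero +_) (sum-replicate-zero n) ⟩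
    f zero + 0ℚ             ≡⟨ +-identityʳ (f zero) ⟩
    f zero                  ∎
  ∑-δ {suc n} (suc k) f = begin
    0ℚ * f zero + ∑[ l < n ] (δ k l * f (suc l))
      ≡⟨ cong₂ _+_ (*-zeroˡ (f zero)) (∑-δ k (f ∘ suc)) ⟩
    0ℚ + f (suc k)  ≡⟨ +-identityˡ (f (suc k)) ⟩
    f (suc k)       ∎

  ∑-linear : ∀ {n} (a : ℚ) (f g : Fin n → ℚ) →
             ∑[ i < n ] (f i + a * g i) ≡ sum f + a * sum g
  ∑-linear a f g =
    trans (∑-distrib-+ f (λ i → a * g i)) (cong (λ x → sum f + x) (sym (*-distribˡ-sum a g)))

  ∑-0 : ∀ {n} (f : Fin n → ℚ) → (∀ i → f i ≡ 0ℚ) → sum f ≡ 0ℚ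
  ∑-0 {n} f f≡0 = trans (sum-cong-≗ f≡0) (sum-replicate-zero n)

  Solution : ∀ {m n} → (Fin m → Fin n → ℚ) → (Fin m → ℚ) → Set
  Solution {n = n} A b = ∃ λ (x : Fin n → ℚ) → ∀ r → ∑[ c < n ] (A r c * x c) ≡ b r

  Obstruction : ∀ {m n} → (Fin m → Fin n → ℚ) → (Fin m → ℚ) → Set
  Obstruction {m} A b =
    ∃ λ (y : Fin m → ℚ) → (∀ c → ∑[ r < m ] (y r * A r c) ≡ 0ℚ) × ∑[ r < m ] (y r * b r) ≢ 0ℚ

  -- Fredholm alternative, by Gaussian elimination.
  fredholm : ∀ {m} n (A : Fin m → Fin n → ℚ) b → Solution A b ⊎ Obstruction A b
  fredholm {m} zero A b with any? (λ r → ¬? (b r ≟ 0ℚ))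
  ... | yes (r , br≢0) =
    inj₂ (δ r , (λ ()) , λ e → br≢0 (trans (sym (∑-δ r b)) e))
  ... | no b≡0 =
    inj₁ ((λ ()) , λ r → sym (decidable-stable (b r ≟ 0ℚ) (λ br≢0 → b≡0 (r , br≢0))))
  fredholm {m} (suc n) A b with any? (λ r → ¬? (A r zero ≟ 0ℚ))
  ... | no A₀≢0 with fredholm n (λ r c → A r (suc c)) b
  ...   | inj₁ (x , Ax≡b) = inj₁ (x′ , λ r → begin
            A r zero * 0ℚ + ∑[ c < n ] (A r (suc c) * x c)
              ≡⟨ cong₂ _+_ (*-zeroʳ (A r zero)) (Ax≡b r) ⟩
            0ℚ + b r  ≡⟨ +-identityˡ (b r) ⟩
            b r       ∎)
    where
    x′ : Fin (suc n) → ℚ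
    x′ zero    = 0ℚ
    x′ (suc c) = x c
  ...   | inj₂ (y , yA≡0 , yb≢0) = inj₂ (y , yA′≡0 , yb≢0)
    where
    A₀≡0 : ∀ r → A r zero ≡ 0ℚ
    A₀≡0 r = decidable-stable (A r zero ≟ 0ℚ) (λ p → A₀≢0 (r , p))
    yA′≡0 : ∀ c → ∑[ r < m ] (y r * A r c) ≡ 0ℚ
    yA′≡0 zero    = ∑-0 _ (λ r → trans (cong (y r *_) (A₀≡0 r)) (*-zeroʳ (y r)))
    yA′≡0 (suc c) = yA≡0 c
  fredholm {m} (suc n) A b | yes (k , p≢0)
    with fredholm n (λ r c → A r (suc c) + (- (A r zero * (1/_ (A k zero) {{≢-nonZero p≢0}}))) * A k (suc c))
                    (λ r → b r + (- (A r zero * (1/_ (A k zero) {{≢-nonZero p≢0}}))) * b k)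
  ... | inj₁ (x , eq) = inj₁ (x′ , λ r → begin
            A r zero * x₀ + S r
              ≡⟨ solve 5 (λ a q bk sk s → a :* (q :* (bk :+ :- sk)) :+ s
                   := (s :+ (:- (a :* q)) :* sk) :+ (a :* q) :* bk) refl
                   (A r zero) q (b k) (S k) (S r) ⟩
            (S r + μ r * S k) + (A r zero * q) * b k
              ≡⟨ cong (_+ (A r zero * q) * b k) (trans (sym (expand r)) (eq r)) ⟩
            (b r + μ r * b k) + (A r zero * q) * b k
              ≡⟨ solve 3 (λ br aq bk → (br :+ (:- aq) :* bk) :+ aq :* bk := br) refl
                   (b r) (A r zero * q) (b k) ⟩
            b r ∎)
    where
    q : ℚ
    q = 1/_ (A k zero) {{≢-nonZero p≢0}}
    μ : Fin m → ℚ
    μ r = - (A r zero * q)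
    S : Fin m → ℚ
    S r = ∑[ c < n ] (A r (suc c) * x c)
    x₀ : ℚ
    x₀ = q * (b k + - S k)
    x′ : Fin (suc n) → ℚ
    x′ zero    = x₀
    x′ (suc c) = x c
    expand : ∀ r → ∑[ c < n ] ((A r (suc c) + μ r * A k (suc c)) * x c) ≡ S r + μ r * S k
    expand r = trans
      (sum-cong-≗ {n} λ c → solve 4 (λ a u e z → (a :+ u :* e) :* z := a :* z :+ u :* (e :* z)) refl
        (A r (suc c)) (μ r) (A k (suc c)) (x c))
      (∑-linear (μ r) (λ c → A r (suc c) * x c) (λ c → A k (suc c) * x c))
  ... | inj₂ (y , yA≡0 , yb≢0) = inj₂ (y′ , y′A≡0 , λ e → yb≢0 (trans (sym (transfer b)) e))
    where
    q : ℚ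
    q = 1/_ (A k zero) {{≢-nonZero p≢0}}
    T : ℚ
    T = ∑[ r < m ] (y r * A r zero)
    y′ : Fin m → ℚ
    y′ r = y r + (- (T * q)) * δ k r
    reduce : ∀ (f : Fin m → ℚ) → ∑[ r < m ] (y′ r * f r) ≡ sum (λ r → y r * f r) + (- (T * q)) * f k
    reduce f = begin
      ∑[ r < m ] (y′ r * f r)
        ≡⟨ sum-cong-≗ {m} (λ r → solve 4 (λ a u e z → (a :+ u :* e) :* z := a :* z :+ u :* (e :* z)) refl
             (y r) (- (T * q)) (δ k r) (f r)) ⟩
      ∑[ r < m ] (y r * f r + (- (T * q)) * (δ k r * f r))
        ≡⟨ ∑-linear (- (T * q)) (λ r → y r * f r) (λ r → δ k r * f r) ⟩
      sum (λ r → y r * f r) + (- (T * q)) * sum (λ r → δ k r * f r)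
        ≡⟨ cong (λ z → sum (λ r → y r * f r) + (- (T * q)) * z) (∑-δ k f) ⟩
      sum (λ r → y r * f r) + (- (T * q)) * f k ∎
    transfer : ∀ (f : Fin m → ℚ) → ∑[ r < m ] (y′ r * f r) ≡
               ∑[ r < m ] (y r * (f r + (- (A r zero * q)) * f k))
    transfer f = trans (reduce f) (sym (begin
      ∑[ r < m ] (y r * (f r + (- (A r zero * q)) * f k))
        ≡⟨ sum-cong-≗ {m} (λ r → solve 5 (λ z f a q g → z :* (f :+ (:- (a :* q)) :* g) :=
             z :* f :+ (:- (q :* g)) :* (z :* a)) refl (y r) (f r) (A r zero) q (f k)) ⟩
      ∑[ r < m ] (y r * f r + (- (q * f k)) * (y r * A r zero))
        ≡⟨ ∑-linear (- (q * f k)) (λ r → y r * f r) (λ r → y r * A r zero) ⟩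
      sum (λ r → y r * f r) + (- (q * f k)) * T
        ≡⟨ solve 4 (λ s q g t → s :+ (:- (q :* g)) :* t := s :+ (:- (t :* q)) :* g) refl
             (sum (λ r → y r * f r)) q (f k) T ⟩
      sum (λ r → y r * f r) + (- (T * q)) * f k ∎))
    y′A≡0 : ∀ c → ∑[ r < m ] (y′ r * A r c) ≡ 0ℚ
    y′A≡0 zero = begin
      ∑[ r < m ] (y′ r * A r zero)  ≡⟨ reduce (λ r → A r zero) ⟩
      T + (- (T * q)) * A k zero
        ≡⟨ solve 3 (λ t q a → t :+ (:- (t :* q)) :* a := t :+ :- (t :* (q :* a))) refl T q (A k zero) ⟩
      T + - (T * (q * A k zero))
        ≡⟨ cong (λ z → T + - (T * z)) (*-inverseˡ (A k zero) {{≢-nonZero p≢0}}) ⟩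
      T + - (T * 1ℚ)  ≡⟨ cong (λ z → T + - z) (*-identityʳ T) ⟩
      T + - T         ≡⟨ +-inverseʳ T ⟩
      0ℚ              ∎
    y′A≡0 (suc c) = trans (transfer (λ r → A r (suc c))) (yA≡0 c)

  square-nonNeg : ∀ p → 0ℚ ≤ p * p
  square-nonNeg p with ≤-total 0ℚ p
  ... | inj₁ 0≤p = nonNegative⁻¹ (p * p) {{nonNeg*nonNeg⇒nonNeg p {{nonNegative 0≤p}} p {{nonNegative 0≤p}}}}
  ... | inj₂ p≤0 = nonNegative⁻¹ (p * p) {{nonPos*nonPos⇒nonPos p {{nonPositive p≤0}} p {{nonPositive p≤0}}}}

  square≡0⇒≡0 : ∀ p → p * p ≡ 0ℚ → p ≡ 0ℚ
  square≡0⇒≡0 p pp≡0 with p ≟ 0ℚ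
  ... | yes p≡0 = p≡0
  ... | no  p≢0 = begin
    p                ≡⟨ *-identityˡ p ⟨
    1ℚ * p           ≡⟨ cong (_* p) (*-inverseˡ p) ⟨
    1/ p * p * p     ≡⟨ *-assoc (1/ p) p p ⟩
    1/ p * (p * p)   ≡⟨ cong (1/ p *_) pp≡0 ⟩
    1/ p * 0ℚ        ≡⟨ *-zeroʳ (1/ p) ⟩
    0ℚ               ∎
    where instance _ = ≢-nonZero p≢0

  ∑-nonNeg : ∀ {n} (f : Fin n → ℚ) → (∀ i → 0ℚ ≤ f i) → 0ℚ ≤ sum f
  ∑-nonNeg {zero}  f 0≤f = ≤-refl
  ∑-nonNeg {suc n} f 0≤f = +-mono-≤ (0≤f zero) (∑-nonNeg (f ∘ suc) (0≤f ∘ suc))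

  ∑≡0⇒≡0 : ∀ {n} (f : Fin n → ℚ) → (∀ i → 0ℚ ≤ f i) → sum f ≡ 0ℚ → ∀ i → f i ≡ 0ℚ
  ∑≡0⇒≡0 {suc n} f 0≤f ∑f≡0 i = pick i
    where
    f₀≡0 : f zero ≡ 0ℚ
    f₀≡0 = ≤-antisym
      (subst₂ _≤_ (+-identityʳ (f zero)) ∑f≡0
        (+-monoʳ-≤ (f zero) (∑-nonNeg (f ∘ suc) (0≤f ∘ suc))))
      (0≤f zero)
    rest≡0 : sum (f ∘ suc) ≡ 0ℚ
    rest≡0 = trans (sym (+-identityˡ _)) (trans (cong (_+ sum (f ∘ suc)) (sym f₀≡0)) ∑f≡0)
    pick : ∀ i → f i ≡ 0ℚ
    pick zero    = f₀≡0
    pick (suc i) = ∑≡0⇒≡0 (f ∘ suc) (0≤f ∘ suc) rest≡0 i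

  module _ {N} (G : Graph N) where
    open Graph G

    adj : Fin N → Fin N → ℚ
    adj k l = if does (k ~? l) then 1ℚ else 0ℚ

    adj-sym : ∀ k l → adj k l ≡ adj l k
    adj-sym k l with k ~? l | l ~? k
    ... | yes _   | yes _   = refl
    ... | yes k~l | no ¬l~k = contradiction (sym-~ k~l) ¬l~k
    ... | no ¬k~l | yes l~k = contradiction (sym-~ l~k) ¬k~l
    ... | no _    | no _    = refl

    adj-nonNeg : ∀ k l → 0ℚ ≤ adj k l
    adj-nonNeg k l with k ~? l
    ... | yes _ = nonNegative⁻¹ 1ℚ
    ... | no  _ = ≤-refl

    adj-~ : ∀ {k l} → k ~ l → adj k l ≡ 1ℚ
    adj-~ {k} {l} k~l with k ~? l
    ... | yes _   = refl
    ... | no ¬k~l = contradiction k~l ¬k~l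

    outflow-adj : ∀ v k → outflow G v k ≡ ∑[ l < N ] (adj k l * (v k - v l))
    outflow-adj v k = sum-cong-≗ {N} pointwise
      where
      pointwise : ∀ l → (if does (k ~? l) then v k - v l else 0ℚ) ≡ adj k l * (v k - v l)
      pointwise l with k ~? l
      ... | yes _ = sym (*-identityˡ (v k - v l))
      ... | no  _ = sym (*-zeroˡ (v k - v l))

    laplacian : Fin N → Fin N → ℚ
    laplacian k l = sum (adj k) * δ k l + - adj k l

    laplacian-sym : ∀ k l → laplacian k l ≡ laplacian l k
    laplacian-sym k l = cong₂ (λ x y → x + - y) diagonal (adj-sym k l)
      where
      diagonal : sum (adj k) * δ k l ≡ sum (adj l) * δ l k
      diagonal with k Fin.≟ l | l Fin.≟ k
      ... | yes refl | yes _  = refl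
      ... | yes k≡l  | no l≢k = contradiction (sym k≡l) l≢k
      ... | no k≢l | yes l≡k  = contradiction (sym l≡k) k≢l
      ... | no _   | no _     = trans (*-zeroʳ (sum (adj k))) (sym (*-zeroʳ (sum (adj l))))

    outflow-laplacian : ∀ v k → ∑[ l < N ] (laplacian k l * v l) ≡ outflow G v k
    outflow-laplacian v k = begin
      ∑[ l < N ] ((D * δ k l + - adj k l) * v l)
        ≡⟨ sum-cong-≗ {N} (λ l → solve 4 (λ d e a z → (d :* e :+ :- a) :* z := :- (a :* z) :+ d :* (e :* z)) refl
             D (δ k l) (adj k l) (v l)) ⟩
      ∑[ l < N ] (- (adj k l * v l) + D * (δ k l * v l))
        ≡⟨ ∑-linear D (λ l → - (adj k l * v l)) (λ l → δ k l * v l) ⟩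
      sum (λ l → - (adj k l * v l)) + D * sum (λ l → δ k l * v l)
        ≡⟨ cong (λ z → sum (λ l → - (adj k l * v l)) + D * z) (∑-δ k v) ⟩
      sum (λ l → - (adj k l * v l)) + D * v k
        ≡⟨ cong (λ z → sum (λ l → - (adj k l * v l)) + z) (*-comm D (v k)) ⟩
      sum (λ l → - (adj k l * v l)) + v k * D
        ≡⟨ ∑-linear (v k) (λ l → - (adj k l * v l)) (adj k) ⟨
      ∑[ l < N ] (- (adj k l * v l) + v k * adj k l)
        ≡⟨ sum-cong-≗ {N} (λ l → solve 3 (λ a z u → :- (a :* z) :+ u :* a := a :* (u :+ :- z)) refl
             (adj k l) (v l) (v k)) ⟩
      ∑[ l < N ] (adj k l * (v k - v l))
        ≡⟨ outflow-adj v k ⟨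
      outflow G v k ∎
      where
      D : ℚ
      D = sum (adj k)

    energy : (Fin N → ℚ) → ℚ
    energy v = ∑[ k < N ] ∑[ l < N ] (adj k l * ((v k - v l) * (v k - v l)))

    energy-outflow : ∀ v → energy v ≡ sum (λ k → v k * outflow G v k) + sum (λ k → v k * outflow G v k)
    energy-outflow v = begin
      energy v
        ≡⟨ sum-cong-≗ {N} (λ k → sum-cong-≗ {N} (λ l → trans
             (solve 3 (λ a x y → a :* ((x :+ :- y) :* (x :+ :- y))
                := x :* (a :* (x :+ :- y)) :+ y :* (a :* (y :+ :- x))) refl (adj k l) (v k) (v l))
             (cong (λ a → F k l + v l * (a * (v l - v k))) (adj-sym k l)))) ⟩
      ∑[ k < N ] ∑[ l < N ] (F k l + F l k)
        ≡⟨ sum-cong-≗ {N} (λ k → ∑-distrib-+ (F k) (λ l → F l k)) ⟩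
      ∑[ k < N ] (sum (F k) + sum (λ l → F l k))
        ≡⟨ ∑-distrib-+ (λ k → sum (F k)) (λ k → sum (λ l → F l k)) ⟩
      sum (λ k → sum (F k)) + sum (λ k → sum (λ l → F l k))
        ≡⟨ cong (λ z → sum (λ k → sum (F k)) + z) (sym (∑-comm F)) ⟩
      sum (λ k → sum (F k)) + sum (λ k → sum (F k))
        ≡⟨ cong₂ _+_ collect collect ⟩
      sum (λ k → v k * outflow G v k) + sum (λ k → v k * outflow G v k) ∎
      where
      F : Fin N → Fin N → ℚ
      F k l = v k * (adj k l * (v k - v l))
      collect : sum (λ k → sum (F k)) ≡ sum (λ k → v k * outflow G v k)
      collect = sum-cong-≗ {N} (λ k → trans
        (sym (*-distribˡ-sum (v k) (λ l → adj k l * (v k - v l))))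
        (cong (v k *_) (sym (outflow-adj v k))))

    harmonic⇒constant : Connected G → ∀ v → (∀ k → outflow G v k ≡ 0ℚ) → ∀ i j → v i ≡ v j
    harmonic⇒constant conn v outflow≡0 i j = along (conn i j)
      where
      energy≡0 : energy v ≡ 0ℚ
      energy≡0 = trans (energy-outflow v) (cong₂ _+_ z z)
        where
        z : sum (λ k → v k * outflow G v k) ≡ 0ℚ
        z = ∑-0 _ (λ k → trans (cong (v k *_) (outflow≡0 k)) (*-zeroʳ (v k)))
      term : Fin N → Fin N → ℚ
      term k l = adj k l * ((v k - v l) * (v k - v l))
      term-nonNeg : ∀ k l → 0ℚ ≤ term k l
      term-nonNeg k l = nonNegative⁻¹ (term k l)
        {{nonNeg*nonNeg⇒nonNeg (adj k l) {{nonNegative (adj-nonNeg k l)}}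
          ((v k - v l) * (v k - v l)) {{nonNegative (square-nonNeg (v k - v l))}}}}
      term≡0 : ∀ k l → term k l ≡ 0ℚ
      term≡0 k = ∑≡0⇒≡0 (term k) (term-nonNeg k)
        (∑≡0⇒≡0 (λ k → sum (term k)) (λ k → ∑-nonNeg (term k) (term-nonNeg k)) energy≡0 k)
      across : ∀ {k l} → k ~ l → v k ≡ v l
      across {k} {l} k~l = begin
        v k              ≡⟨ solve 2 (λ x y → x := (x :+ :- y) :+ y) refl (v k) (v l) ⟩
        (v k - v l) + v l ≡⟨ cong (_+ v l) (square≡0⇒≡0 (v k - v l) sq≡0) ⟩
        0ℚ + v l         ≡⟨ +-identityˡ (v l) ⟩
        v l              ∎
        where
        sq≡0 : (v k - v l) * (v k - v l) ≡ 0ℚ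
        sq≡0 = trans (sym (*-identityˡ _))
          (trans (cong (_* ((v k - v l) * (v k - v l))) (sym (adj-~ k~l))) (term≡0 k l))
      along : ∀ {k l} → Star _~_ k l → v k ≡ v l
      along ε           = refl
      along (k~m ◅ m⋯l) = trans (across k~m) (along m⋯l)

    potential-exists : Connected G → ∀ s t → ∃ (IsPotential G s t)
    potential-exists conn s t with fredholm N laplacian (λ k → δ s k - δ t k)
    ... | inj₁ (v , Lv≡b) = v , λ k → trans (sym (outflow-laplacian v k)) (Lv≡b k)
    ... | inj₂ (y , yL≡0 , yb≢0) = contradiction yb≡0 yb≢0
      where
      harmonic : ∀ k → outflow G y k ≡ 0ℚ
      harmonic k = trans (sym (outflow-laplacian y k)) (trans
        (sum-cong-≗ {N} (λ l → trans (cong (_* y l) (laplacian-sym k l)) (*-comm (laplacian l k) (y l))))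
        (yL≡0 k))
      yb≡0 : ∑[ k < N ] (y k * (δ s k - δ t k)) ≡ 0ℚ
      yb≡0 = begin
        ∑[ k < N ] (y k * (δ s k - δ t k))
          ≡⟨ sum-cong-≗ {N} (λ k → solve 3 (λ z a b → z :* (a :+ :- b) := a :* z :+ (:- con 1ℚ) :* (b :* z))
               refl (y k) (δ s k) (δ t k)) ⟩
        ∑[ k < N ] (δ s k * y k + - 1ℚ * (δ t k * y k))
          ≡⟨ ∑-linear (- 1ℚ) (λ k → δ s k * y k) (λ k → δ t k * y k) ⟩
        sum (λ k → δ s k * y k) + - 1ℚ * sum (λ k → δ t k * y k)
          ≡⟨ cong₂ (λ a b → a + - 1ℚ * b) (∑-δ s y) (∑-δ t y) ⟩
        y s + - 1ℚ * y t
          ≡⟨ cong (λ z → y s + - 1ℚ * z) (harmonic⇒constant conn y harmonic t s) ⟩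
        y s + - 1ℚ * y s
          ≡⟨ solve 1 (λ z → z :+ (:- con 1ℚ) :* z := con 0ℚ) refl (y s) ⟩
        0ℚ ∎

    potential-unique : Connected G → ∀ {s t v w} → IsPotential G s t v → IsPotential G s t w →
                       ∀ i j → v i - v j ≡ w i - w j
    potential-unique conn {s} {t} {v} {w} pv pw i j = begin
      v i - v j
        ≡⟨ solve 4 (λ a b c d → a :+ :- b := (a :+ :- c) :+ (c :+ :- b)) refl (v i) (v j) (w i) (w j) ⟩
      (v i - w i) + (w i - v j)
        ≡⟨ cong (_+ (w i - v j)) (harmonic⇒constant conn (λ k → v k - w k) harmonic i j) ⟩
      (v j - w j) + (w i - v j)
        ≡⟨ solve 3 (λ b c d → (b :+ :- d) :+ (c :+ :- b) := c :+ :- d) refl (v j) (w i) (w j) ⟩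
      w i - w j ∎
      where
      harmonic : ∀ k → outflow G (λ k → v k - w k) k ≡ 0ℚ
      harmonic k = begin
        outflow G (λ k → v k - w k) k
          ≡⟨ outflow-adj (λ k → v k - w k) k ⟩
        ∑[ l < N ] (adj k l * ((v k - w k) - (v l - w l)))
          ≡⟨ sum-cong-≗ {N} (λ l → solve 5 (λ a b c d e → a :* ((b :+ :- c) :+ :- (d :+ :- e))
                 := a :* (b :+ :- d) :+ (:- con 1ℚ) :* (a :* (c :+ :- e))) refl
               (adj k l) (v k) (w k) (v l) (w l)) ⟩
        ∑[ l < N ] (adj k l * (v k - v l) + - 1ℚ * (adj k l * (w k - w l)))
          ≡⟨ ∑-linear (- 1ℚ) (λ l → adj k l * (v k - v l)) (λ l → adj k l * (w k - w l)) ⟩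
        sum (λ l → adj k l * (v k - v l)) + - 1ℚ * sum (λ l → adj k l * (w k - w l))
          ≡⟨ cong₂ (λ a b → a + - 1ℚ * b) (trans (sym (outflow-adj v k)) (pv k))
                                            (trans (sym (outflow-adj w k)) (pw k)) ⟩
        (δ s k - δ t k) + - 1ℚ * (δ s k - δ t k)
          ≡⟨ solve 1 (λ z → z :+ (:- con 1ℚ) :* z := con 0ℚ) refl (δ s k - δ t k) ⟩
        0ℚ ∎

opaque
  potential : ∀ {N} (G : Graph N) → Connected G → Fin N → Fin N → Fin N → ℚ
  potential G conn i j = proj₁ (potential-exists G conn i j)

  potential-isPotential : ∀ {N} (G : Graph N) (conn : Connected G) i j →
                          IsPotential G i j (potential G conn i j)
  potential-isPotential G conn i j = proj₂ (potential-exists G conn i j)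

-- The voltage between i and j when a unit current flows from i to j; by
-- potential-unique it does not depend on the chosen potential.
resistance : ∀ {N} (G : Graph N) → Connected G → Fin N → Fin N → ℚ
resistance G conn i j = potential G conn i j i - potential G conn i j j

R⁺ : ∀ {N} (G : Graph N) → Connected G → ℚ
R⁺ {N} G conn = ∑[ i < N ] ∑[ j < N ]
  (if does (i Fin.<? j)
   then fromℕ (degree G i ℕ.+ degree G j) * resistance G conn i j
   else 0ℚ)

{-# OPTIONS --safe #-}
module Submission where

-- By Dirichlet's principle, a test potential supported on i and j bounds R i j
-- from below: by 1/dᵢ + 1/dⱼ if i and j are not adjacent, and if they are, by a
-- number falling short of it by at most 4/((1+d₁)(dᵢ+dⱼ)).  Weighted by dᵢ + dⱼ and
-- summed over all pairs, 1/dᵢ + 1/dⱼ gives N(N-2) + 2|E| ∑ 1/dⱼ, since ∑ dᵢ = 2|E|,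
-- while each edge loses at most 4/(1+d₁).

open import Defs
open import Data.Bool.Base using (true; false; if_then_else_)
open import Data.Fin.Base using (Fin; fromℕ<)
import Data.Fin.Base as Fin
open import Data.Fin.Permutation using (_⟨$⟩ˡ_; inverseʳ)
import Data.Fin.Properties as Fin
open import Data.Integer.Base using (+_)
import Data.Integer.Base as ℤ
import Data.Integer.Properties as ℤ
open import Data.Nat.Base as ℕ using (ℕ; zero; suc; z≤n; z<s)
open import Data.Nat.Properties as ℕ using ()
open import Data.Product.Base using (∃; _,_; proj₂)
open import Data.Rational.Base using (ℚ; _+_; _-_; _*_; _/_; _≥_;
  -_; _≤_; 0ℚ; 1ℚ; fromℚᵘ; toℚᵘ; nonNegative)
open import Data.Rational.Properties
open import Data.Rational.Solver using (module +-*-Solver)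
import Data.Rational.Unnormalised.Base as ℚᵘ
import Data.Rational.Unnormalised.Properties as ℚᵘ
open import Data.Sum.Base using (_⊎_; inj₁; inj₂)
open import Function.Base using (_∘_)
open import Relation.Binary.Construct.Closure.ReflexiveTransitive using (Star; ε; _◅_)
open import Relation.Binary.Definitions using (tri<; tri≈; tri>)
open import Relation.Binary.PropositionalEquality
open import Relation.Nullary.Decidable using (Dec; does; yes; no; _×-dec_; dec-true; dec-false)
open import Relation.Nullary.Negation using (contradiction)

open +-*-Solver

-- Arithmetic and order of the rationals `fromℕ n` and `recip n`.

fromℚᵘ-homo-+ : ∀ p q → fromℚᵘ (p ℚᵘ.+ q) ≡ fromℚᵘ p + fromℚᵘ q
-- Normalised fractions do not add by computation, so both sides are compared as unnormalised ones,
-- where equivalence suffices and `toℚᵘ` is a homomorphism.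
fromℚᵘ-homo-+ p q = toℚᵘ-injective (begin
  toℚᵘ (fromℚᵘ (p ℚᵘ.+ q))               ≈⟨ toℚᵘ-fromℚᵘ (p ℚᵘ.+ q) ⟩
  p ℚᵘ.+ q                               ≈⟨ ℚᵘ.+-cong (toℚᵘ-fromℚᵘ p) (toℚᵘ-fromℚᵘ q) ⟨
  toℚᵘ (fromℚᵘ p) ℚᵘ.+ toℚᵘ (fromℚᵘ q)   ≈⟨ toℚᵘ-homo-+ (fromℚᵘ p) (fromℚᵘ q) ⟨
  toℚᵘ (fromℚᵘ p + fromℚᵘ q)             ∎)
  where open ℚᵘ.≃-Reasoning

fromℚᵘ-homo-* : ∀ p q → fromℚᵘ (p ℚᵘ.* q) ≡ fromℚᵘ p * fromℚᵘ q
fromℚᵘ-homo-* p q = toℚᵘ-injective (begin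
  toℚᵘ (fromℚᵘ (p ℚᵘ.* q))               ≈⟨ toℚᵘ-fromℚᵘ (p ℚᵘ.* q) ⟩
  p ℚᵘ.* q                               ≈⟨ ℚᵘ.*-cong (toℚᵘ-fromℚᵘ p) (toℚᵘ-fromℚᵘ q) ⟨
  toℚᵘ (fromℚᵘ p) ℚᵘ.* toℚᵘ (fromℚᵘ q)   ≈⟨ toℚᵘ-homo-* (fromℚᵘ p) (fromℚᵘ q) ⟨
  toℚᵘ (fromℚᵘ p * fromℚᵘ q)             ∎)
  where open ℚᵘ.≃-Reasoning

fromℕ-homo-+ : ∀ m n → fromℕ (m ℕ.+ n) ≡ fromℕ m + fromℕ n
fromℕ-homo-+ m n = trans
  -- The unnormalised sum of `m / 1` and `n / 1` has the numerator `m * 1 + n * 1`.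
  (cong (_/ 1) (sym (cong₂ ℤ._+_ (ℤ.*-identityʳ (+ m)) (ℤ.*-identityʳ (+ n)))))
  (fromℚᵘ-homo-+ (ℚᵘ.mkℚᵘ (+ m) 0) (ℚᵘ.mkℚᵘ (+ n) 0))

fromℕ-homo-* : ∀ m n → fromℕ (m ℕ.* n) ≡ fromℕ m * fromℕ n
fromℕ-homo-* m n = trans (cong (_/ 1) (ℤ.pos-* m n))
  (fromℚᵘ-homo-* (ℚᵘ.mkℚᵘ (+ m) 0) (ℚᵘ.mkℚᵘ (+ n) 0))

/≡fromℕ*recip : ∀ m n → (+ m) / suc n ≡ fromℕ m * recip (suc n)
/≡fromℕ*recip m n = trans
  (/-cong {p₁ = + m} {q₁ = suc n} (sym (ℤ.*-identityʳ (+ m))) (sym (ℕ.*-identityˡ (suc n))))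
  (fromℚᵘ-homo-* (ℚᵘ.mkℚᵘ (+ m) 0) (ℚᵘ.mkℚᵘ (+ 1) n))

recip-inverse : ∀ n → recip (suc n) * fromℕ (suc n) ≡ 1ℚ
recip-inverse n = trans (*-comm (recip (suc n)) (fromℕ (suc n))) (trans
  (sym (/≡fromℕ*recip (suc n) n))
  (fromℚᵘ-cong {ℚᵘ.mkℚᵘ (+ suc n) n} {ℚᵘ.mkℚᵘ (+ 1) 0}
    (ℚᵘ.*≡* (ℤ.*-comm (+ suc n) (+ 1)))))

recip-inverse′ : ∀ {n} → 0 ℕ.< n → recip n * fromℕ n ≡ 1ℚ
recip-inverse′ {suc n} _ = recip-inverse n

fromℕ-nonNeg : ∀ n → 0ℚ ≤ fromℕ n
fromℕ-nonNeg n = nonNegative⁻¹ (fromℕ n) {{normalize-nonNeg n 1}}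

recip-nonNeg : ∀ n → 0ℚ ≤ recip n
recip-nonNeg zero    = ≤-refl
recip-nonNeg (suc n) = nonNegative⁻¹ (recip (suc n)) {{normalize-nonNeg 1 (suc n)}}

-- The two sides differ by `fromℕ (n ∸ m)`, which is nonnegative.
fromℕ-mono : ∀ {m n} → m ℕ.≤ n → fromℕ m ≤ fromℕ n
fromℕ-mono {m} {n} m≤n = begin
  fromℕ m                       ≡⟨ +-identityʳ (fromℕ m) ⟨
  fromℕ m + 0ℚ                  ≤⟨ +-monoʳ-≤ (fromℕ m) (fromℕ-nonNeg (n ℕ.∸ m)) ⟩
  fromℕ m + fromℕ (n ℕ.∸ m)     ≡⟨ fromℕ-homo-+ m (n ℕ.∸ m) ⟨
  fromℕ (m ℕ.+ (n ℕ.∸ m))       ≡⟨ cong fromℕ (ℕ.m+[n∸m]≡n m≤n) ⟩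
  fromℕ n                       ∎
  where open ≤-Reasoning

0≤+ : ∀ {p q} → 0ℚ ≤ p → 0ℚ ≤ q → 0ℚ ≤ p + q
0≤+ = +-mono-≤

0≤* : ∀ {p q} → 0ℚ ≤ p → 0ℚ ≤ q → 0ℚ ≤ p * q
0≤* {p} {q} 0≤p 0≤q = nonNegative⁻¹ (p * q)
  {{nonNeg*nonNeg⇒nonNeg p {{nonNegative 0≤p}} q {{nonNegative 0≤q}}}}

p≤q⇒0≤q-p : ∀ {p q} → p ≤ q → 0ℚ ≤ q - p
p≤q⇒0≤q-p {p} {q} p≤q = subst (_≤ q - p) (+-inverseʳ p) (+-monoˡ-≤ (- p) p≤q)

0≤q-p⇒p≤q : ∀ {p q} → 0ℚ ≤ q - p → p ≤ q
0≤q-p⇒p≤q {p} {q} 0≤ = subst₂ _≤_ (+-identityʳ p)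
  (solve 2 (λ p q → p :+ (q :- p) := q) refl p q) (+-monoʳ-≤ p 0≤)

-- Finite sums and sums over pairs of indices.

fromℕ-sumℕ : ∀ {n} (f : Fin n → ℕ) → fromℕ (sumℕ f) ≡ sum (fromℕ ∘ f)
fromℕ-sumℕ {zero}  f = refl
fromℕ-sumℕ {suc n} f = trans (fromℕ-homo-+ (f Fin.zero) (sumℕ (f ∘ Fin.suc)))
  (cong (λ x → fromℕ (f Fin.zero) + x) (fromℕ-sumℕ (f ∘ Fin.suc)))

∑-const : ∀ n c → ∑[ i < n ] c ≡ fromℕ n * c
∑-const zero    c = sym (*-zeroˡ c)
∑-const (suc n) c = begin
  c + ∑[ i < n ] c        ≡⟨ cong (λ x → c + x) (∑-const n c) ⟩
  c + fromℕ n * c         ≡⟨ solve 2 (λ c x → c :+ x :* c := (con 1ℚ :+ x) :* c) refl c (fromℕ n) ⟩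
  (1ℚ + fromℕ n) * c      ≡⟨ cong (_* c) (fromℕ-homo-+ 1 n) ⟨
  fromℕ (suc n) * c       ∎
  where open ≡-Reasoning

∑-mono : ∀ {n} {f g : Fin n → ℚ} → (∀ i → f i ≤ g i) → sum f ≤ sum g
∑-mono {zero}  f≤g = ≤-refl
∑-mono {suc n} f≤g = +-mono-≤ (f≤g Fin.zero) (∑-mono (f≤g ∘ Fin.suc))

-- This has the shape of `R⁺`, which is therefore such a sum by definition.
∑< : ∀ {n} → (Fin n → Fin n → ℚ) → ℚ
∑< {n} a = ∑[ i < n ] ∑[ j < n ] (if does (i Fin.<? j) then a i j else 0ℚ)

∑<-cong : ∀ {n} {a b : Fin n → Fin n → ℚ} → (∀ i j → a i j ≡ b i j) → ∑< a ≡ ∑< b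
∑<-cong {n} a≡b = sum-cong-≗ {n} λ i → sum-cong-≗ {n} λ j →
  cong (λ x → if does (i Fin.<? j) then x else 0ℚ) (a≡b i j)

∑<-mono : ∀ {n} {a b : Fin n → Fin n → ℚ} → (∀ {i j} → i Fin.< j → a i j ≤ b i j) → ∑< a ≤ ∑< b
∑<-mono {n} {a} {b} a≤b = ∑-mono λ i → ∑-mono λ j → pointwise i j
  where
  pointwise : ∀ i j → (if does (i Fin.<? j) then a i j else 0ℚ) ≤
                      (if does (i Fin.<? j) then b i j else 0ℚ)
  pointwise i j = by-cases (i Fin.<? j)
    where
    -- With the decision as a variable both `if`s reduce together, and the proof of `i < j` is at
    -- hand for `a≤b`.
    by-cases : (i<?j : Dec (i Fin.< j)) →
               (if does i<?j then a i j else 0ℚ) ≤ (if does i<?j then b i j else 0ℚ)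
    by-cases (yes i<j) = a≤b i<j
    by-cases (no  _)   = ≤-refl

∑<-linear : ∀ {n} c (a b : Fin n → Fin n → ℚ) → ∑< (λ i j → a i j + c * b i j) ≡ ∑< a + c * ∑< b
∑<-linear {n} c a b = trans
  (sum-cong-≗ {n} λ i → trans (sum-cong-≗ {n} (pointwise i))
    (∑-linear c (λ j → if does (i Fin.<? j) then a i j else 0ℚ)
                (λ j → if does (i Fin.<? j) then b i j else 0ℚ)))
  (∑-linear c (λ i → ∑[ j < n ] (if does (i Fin.<? j) then a i j else 0ℚ))
              (λ i → ∑[ j < n ] (if does (i Fin.<? j) then b i j else 0ℚ)))
  where
  pointwise : ∀ i j → (if does (i Fin.<? j) then a i j + c * b i j else 0ℚ) ≡
                      (if does (i Fin.<? j) then a i j else 0ℚ) +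
                      c * (if does (i Fin.<? j) then b i j else 0ℚ)
  pointwise i j with does (i Fin.<? j)
  ... | true  = refl
  ... | false = solve 1 (λ c → con 0ℚ := con 0ℚ :+ c :* con 0ℚ) refl c

-- Each entry lies above, below or on the diagonal, and transposing the part below carries it above.
∑∑-split : ∀ {n} (a : Fin n → Fin n → ℚ) →
           ∑[ i < n ] ∑[ j < n ] a i j ≡ ∑< (λ i j → a i j + a j i) + ∑[ i < n ] a i i
∑∑-split {n} a = begin
  ∑[ i < n ] ∑[ j < n ] a i j
    ≡⟨ sum-cong-≗ {n} (λ i → sum-cong-≗ {n} (trichotomy i)) ⟩
  ∑[ i < n ] ∑[ j < n ] (u i j + l i j + δ i j * a i j)
    ≡⟨ sum-cong-≗ {n} (λ i → trans
         (∑-distrib-+ (λ j → u i j + l i j) (λ j → δ i j * a i j))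
         (cong₂ _+_ (∑-distrib-+ (u i) (l i)) (∑-δ i (a i)))) ⟩
  ∑[ i < n ] (sum (u i) + sum (l i) + a i i)
    ≡⟨ trans (∑-distrib-+ (λ i → sum (u i) + sum (l i)) (λ i → a i i))
         (cong (_+ ∑[ i < n ] a i i) (∑-distrib-+ (λ i → sum (u i)) (λ i → sum (l i)))) ⟩
  ∑< a + ∑[ i < n ] ∑[ j < n ] l i j + ∑[ i < n ] a i i
    -- After `∑-comm` the sum of `l` is literally `∑<` of the transpose; the factor `1ℚ` prepares
    -- for `∑<-linear`.
    ≡⟨ cong (λ x → ∑< a + x + ∑[ i < n ] a i i) (trans (∑-comm l) (sym (*-identityˡ (∑< (λ i j → a j i))))) ⟩
  ∑< a + 1ℚ * ∑< (λ i j → a j i) + ∑[ i < n ] a i i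
    ≡⟨ cong (_+ ∑[ i < n ] a i i) (trans (sym (∑<-linear 1ℚ a (λ i j → a j i)))
         (∑<-cong (λ i j → cong (λ x → a i j + x) (*-identityˡ (a j i))))) ⟩
  ∑< (λ i j → a i j + a j i) + ∑[ i < n ] a i i ∎
  where
  open ≡-Reasoning
  u l : Fin n → Fin n → ℚ
  u i j = if does (i Fin.<? j) then a i j else 0ℚ
  l i j = if does (j Fin.<? i) then a i j else 0ℚ
  trichotomy : ∀ i j → a i j ≡ u i j + l i j + δ i j * a i j
  trichotomy i j with Fin.<-cmp i j
  ... | tri< i<j i≢j j≮i
    rewrite dec-true (i Fin.<? j) i<j | dec-false (i Fin.≟ j) i≢j | dec-false (j Fin.<? i) j≮i
    = solve 1 (λ x → x := x :+ con 0ℚ :+ con 0ℚ :* x) refl (a i j)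
  ... | tri≈ i≮j i≡j j≮i
    rewrite dec-false (i Fin.<? j) i≮j | dec-true (i Fin.≟ j) i≡j | dec-false (j Fin.<? i) j≮i
    = solve 1 (λ x → x := con 0ℚ :+ con 0ℚ :+ con 1ℚ :* x) refl (a i j)
  ... | tri> i≮j i≢j j<i
    rewrite dec-false (i Fin.<? j) i≮j | dec-false (i Fin.≟ j) i≢j | dec-true (j Fin.<? i) j<i
    = solve 1 (λ x → x := con 0ℚ :+ x :+ con 0ℚ :* x) refl (a i j)

-- The Laplacian form, degrees, and lower bounds for resistances.

-- The Dirichlet form at the potential taking the value x at one vertex, - y at
-- another and 0 elsewhere, subtracted from twice its voltage; A and B are the
-- degrees of the two vertices and c is 1 or 0 as they are adjacent or not.
dualValue : (c A B x y : ℚ) → ℚ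
dualValue c A B x y = (x + y) + (x + y) - (x * (x * A + y * c) + y * (x * c + y * B))

-- Lets the edge estimate be proved only with the smaller degree first.
dualValue-swap : ∀ c A B x y → dualValue c A B x y ≡ dualValue c B A y x
dualValue-swap = solve 5 (λ c A B x y →
  (x :+ y) :+ (x :+ y) :- (x :* (x :* A :+ y :* c) :+ y :* (x :* c :+ y :* B)) :=
  (y :+ x) :+ (y :+ x) :- (y :* (y :* B :+ x :* c) :+ x :* (y :* c :+ x :* A))) refl

module _ {N} (G : Graph N) where
  open Graph G
  open ≡-Reasoning

  -- The bilinear form of the Laplacian. Writing it with `outflow` lets Kirchhoff's law evaluate it
  -- when the second argument is a potential.
  ⟨_,_⟩ : (Fin N → ℚ) → (Fin N → ℚ) → ℚ
  ⟨ u , v ⟩ = ∑[ k < N ] (u k * outflow G v k)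

  -- Inherited from the symmetry of the Laplacian, after exchanging the two summations.
  ⟨⟩-sym : ∀ u v → ⟨ u , v ⟩ ≡ ⟨ v , u ⟩
  ⟨⟩-sym u v = begin
    ⟨ u , v ⟩
      ≡⟨ expand u v ⟩
    ∑[ k < N ] ∑[ l < N ] (u k * (laplacian G k l * v l))
      ≡⟨ ∑-comm (λ k l → u k * (laplacian G k l * v l)) ⟩
    ∑[ l < N ] ∑[ k < N ] (u k * (laplacian G k l * v l))
      ≡⟨ sum-cong-≗ {N} (λ l → sum-cong-≗ {N} (λ k → trans
           (cong (λ x → u k * (x * v l)) (laplacian-sym G k l))
           (solve 3 (λ p x q → p :* (x :* q) := q :* (x :* p)) refl (u k) (laplacian G l k) (v l)))) ⟩
    ∑[ l < N ] ∑[ k < N ] (v l * (laplacian G l k * u k))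
      ≡⟨ expand v u ⟨
    ⟨ v , u ⟩ ∎
    where
    expand : ∀ u v → ⟨ u , v ⟩ ≡ ∑[ k < N ] ∑[ l < N ] (u k * (laplacian G k l * v l))
    expand u v = sum-cong-≗ {N} λ k → trans
      (cong (u k *_) (sym (outflow-laplacian G v k)))
      (*-distribˡ-sum (u k) (λ l → laplacian G k l * v l))

  ⟨⟩-linearˡ : ∀ c u v w → ⟨ (λ k → u k + c * v k) , w ⟩ ≡ ⟨ u , w ⟩ + c * ⟨ v , w ⟩
  ⟨⟩-linearˡ c u v w = trans
    (sum-cong-≗ {N} λ k → solve 4 (λ c p q o → (p :+ c :* q) :* o := p :* o :+ c :* (q :* o)) refl
       c (u k) (v k) (outflow G w k))
    (∑-linear c (λ k → u k * outflow G w k) (λ k → v k * outflow G w k))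

  ⟨⟩-linearʳ : ∀ c u v w → ⟨ w , (λ k → u k + c * v k) ⟩ ≡ ⟨ w , u ⟩ + c * ⟨ w , v ⟩
  ⟨⟩-linearʳ c u v w = begin
    ⟨ w , (λ k → u k + c * v k) ⟩  ≡⟨ ⟨⟩-sym w (λ k → u k + c * v k) ⟩
    ⟨ (λ k → u k + c * v k) , w ⟩  ≡⟨ ⟨⟩-linearˡ c u v w ⟩
    ⟨ u , w ⟩ + c * ⟨ v , w ⟩      ≡⟨ cong₂ (λ p q → p + c * q) (⟨⟩-sym u w) (⟨⟩-sym v w) ⟩
    ⟨ w , u ⟩ + c * ⟨ w , v ⟩      ∎

  -- Twice this value is the energy, a sum of nonnegative terms. Instead of halving: if `s ≤ 0`,
  -- then `0 ≤ s + s ≤ s`.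
  ⟨⟩-nonNeg : ∀ v → 0ℚ ≤ ⟨ v , v ⟩
  ⟨⟩-nonNeg v with ≤-total 0ℚ ⟨ v , v ⟩
  ... | inj₁ 0≤ = 0≤
  ... | inj₂ ≤0 = ≤-trans 0≤energy (≤-trans (≤-reflexive (energy-outflow G v))
                    (≤-trans (+-monoʳ-≤ ⟨ v , v ⟩ ≤0) (≤-reflexive (+-identityʳ ⟨ v , v ⟩))))
    where
    0≤energy : 0ℚ ≤ energy G v
    0≤energy = ∑-nonNeg _ λ k → ∑-nonNeg _ λ l →
      0≤* (adj-nonNeg G k l) (square-nonNeg (v k - v l))

  fromℕ-degree : ∀ i → fromℕ (degree G i) ≡ sum (adj G i)
  fromℕ-degree i = trans (fromℕ-sumℕ (λ j → indicator (i ~? j))) (sum-cong-≗ {N} pointwise)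
    where
    pointwise : ∀ j → fromℕ (indicator (i ~? j)) ≡ adj G i j
    pointwise j with i ~? j
    ... | yes _ = refl
    ... | no  _ = refl

  fromℕ-edgeCount : fromℕ (edgeCount G) ≡ ∑< (adj G)
  fromℕ-edgeCount = trans
    (fromℕ-sumℕ (λ i → sumℕ λ j → indicator (i Fin.<? j ×-dec i ~? j)))
    (sum-cong-≗ {N} λ i → trans (fromℕ-sumℕ (λ j → indicator (i Fin.<? j ×-dec i ~? j)))
      (sum-cong-≗ {N} (pointwise i)))
    where
    pointwise : ∀ i j → fromℕ (indicator (i Fin.<? j ×-dec i ~? j)) ≡
                        (if does (i Fin.<? j) then adj G i j else 0ℚ)
    pointwise i j with does (i Fin.<? j) | i ~? j
    ... | true  | yes _ = refl
    ... | true  | no  _ = refl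
    ... | false | _     = refl

  adj-irrefl : ∀ i → adj G i i ≡ 0ℚ
  adj-irrefl i with i ~? i
  ... | yes i~i = contradiction i~i (irrefl refl)
  ... | no  _   = refl

  -- The adjacency matrix is symmetric with zero diagonal, so the sum of its entries is twice the
  -- sum above the diagonal, where each edge occurs once.
  handshake : ∑[ i < N ] fromℕ (degree G i) ≡ fromℕ (2 ℕ.* edgeCount G)
  handshake = begin
    ∑[ i < N ] fromℕ (degree G i)
      ≡⟨ sum-cong-≗ {N} fromℕ-degree ⟩
    ∑[ i < N ] ∑[ j < N ] adj G i j
      ≡⟨ ∑∑-split (adj G) ⟩
    ∑< (λ i j → adj G i j + adj G j i) + ∑[ i < N ] adj G i i
      ≡⟨ cong₂ _+_ (∑<-cong (λ i j → cong (λ x → adj G i j + x)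
           (trans (adj-sym G j i) (sym (*-identityˡ (adj G i j)))))) (∑-0 _ adj-irrefl) ⟩
    ∑< (λ i j → adj G i j + 1ℚ * adj G i j) + 0ℚ
      ≡⟨ cong (_+ 0ℚ) (∑<-linear 1ℚ (adj G) (adj G)) ⟩
    ∑< (adj G) + 1ℚ * ∑< (adj G) + 0ℚ
      -- The new bracketing is that of `2 ℕ.* e`, which computes to `e ℕ.+ (e ℕ.+ 0)`.
      ≡⟨ solve 1 (λ e → e :+ con 1ℚ :* e :+ con 0ℚ := e :+ (e :+ con 0ℚ)) refl (∑< (adj G)) ⟩
    ∑< (adj G) + (∑< (adj G) + 0ℚ)
      ≡⟨ cong (λ e → e + (e + 0ℚ)) fromℕ-edgeCount ⟨
    fromℕ e + (fromℕ e + 0ℚ)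
      ≡⟨ trans (fromℕ-homo-+ e (e ℕ.+ 0)) (cong (λ x → fromℕ e + x) (fromℕ-homo-+ e 0)) ⟨
    fromℕ (2 ℕ.* e) ∎
    where
    e : ℕ
    e = edgeCount G

  -- A walk from `i` to another vertex starts with an edge at `i`, whereas degree zero would make
  -- every `adj G i k` vanish.
  degree>0 : Connected G → ∀ {i j} → i ≢ j → 0 ℕ.< degree G i
  degree>0 conn {i} {j} i≢j with conn i j
  ... | ε                     = contradiction refl i≢j
  ... | _◅_ {j = k} i~k _ = positive (degree G i) refl
    where
    positive : ∀ n → degree G i ≡ n → 0 ℕ.< n
    positive (suc n) _   = z<s
    positive zero    d≡0 = contradiction
      (trans (sym (adj-~ G i~k)) (∑≡0⇒≡0 (adj G i) (adj-nonNeg G i)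
        (trans (sym (fromℕ-degree i)) (cong fromℕ d≡0)) k))
      λ ()

  -- The deltas select two entries of row `i` of the Laplacian: the degree at `i`, there being no
  -- loops, and minus the adjacency at `j`.
  outflow-dipole : ∀ {i j} x y → i ≢ j →
    outflow G (λ k → x * δ i k + (- y) * δ j k) i ≡ x * fromℕ (degree G i) + y * adj G i j
  outflow-dipole {i} {j} x y i≢j = begin
    outflow G (λ k → x * δ i k + (- y) * δ j k) i
      ≡⟨ outflow-laplacian G (λ k → x * δ i k + (- y) * δ j k) i ⟨
    ∑[ l < N ] (laplacian G i l * (x * δ i l + (- y) * δ j l))
      ≡⟨ sum-cong-≗ {N} (λ l → solve 5 (λ e x y p q → e :* (x :* p :+ (:- y) :* q) :=
           x :* (p :* e) :+ (:- y) :* (q :* e)) refl (laplacian G i l) x y (δ i l) (δ j l)) ⟩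
    ∑[ l < N ] (x * (δ i l * laplacian G i l) + (- y) * (δ j l * laplacian G i l))
      ≡⟨ ∑-linear (- y) (λ l → x * (δ i l * laplacian G i l)) (λ l → δ j l * laplacian G i l) ⟩
    ∑[ l < N ] (x * (δ i l * laplacian G i l)) + (- y) * ∑[ l < N ] (δ j l * laplacian G i l)
      ≡⟨ cong₂ (λ p q → p + (- y) * q)
           (trans (sym (*-distribˡ-sum x (λ l → δ i l * laplacian G i l)))
                  (cong (x *_) (∑-δ i (laplacian G i))))
           (∑-δ j (laplacian G i)) ⟩
    x * laplacian G i i + (- y) * laplacian G i j
      ≡⟨ cong₂ (λ p q → x * p + (- y) * q) diagonal off-diagonal ⟩
    x * fromℕ (degree G i) + (- y) * (- adj G i j)
      ≡⟨ cong (λ z → x * fromℕ (degree G i) + z)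
           (solve 2 (λ y a → (:- y) :* (:- a) := y :* a) refl y (adj G i j)) ⟩
    x * fromℕ (degree G i) + y * adj G i j ∎
    where
    diagonal : laplacian G i i ≡ fromℕ (degree G i)
    diagonal = begin
      sum (adj G i) * δ i i + - adj G i i
        ≡⟨ cong₂ (λ p q → sum (adj G i) * (if p then 1ℚ else 0ℚ) + - q)
             (dec-true (i Fin.≟ i) refl) (adj-irrefl i) ⟩
      sum (adj G i) * 1ℚ + - 0ℚ
        ≡⟨ trans (+-identityʳ (sum (adj G i) * 1ℚ)) (*-identityʳ (sum (adj G i))) ⟩
      sum (adj G i)
        ≡⟨ fromℕ-degree i ⟨
      fromℕ (degree G i) ∎
    off-diagonal : laplacian G i j ≡ - adj G i j
    off-diagonal = begin
      sum (adj G i) * δ i j + - adj G i j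
        ≡⟨ cong (λ p → sum (adj G i) * (if p then 1ℚ else 0ℚ) + - adj G i j)
             (dec-false (i Fin.≟ j) i≢j) ⟩
      sum (adj G i) * 0ℚ + - adj G i j
        ≡⟨ cong (_+ - adj G i j) (*-zeroʳ (sum (adj G i))) ⟩
      0ℚ + - adj G i j
        ≡⟨ +-identityˡ (- adj G i j) ⟩
      - adj G i j ∎

  -- Dirichlet's principle: for the potential v of a unit current from i to j,
  -- ⟨ v - f , v - f ⟩ ≥ 0 says ⟨ v , v ⟩ ≥ 2 ⟨ f , v ⟩ - ⟨ f , f ⟩.
  resistance-lower : ∀ (conn : Connected G) {i j} → i ≢ j → ∀ x y →
    dualValue (adj G i j) (fromℕ (degree G i)) (fromℕ (degree G j)) x y ≤ resistance G conn i j
  resistance-lower conn {i} {j} i≢j x y = 0≤q-p⇒p≤q (subst (0ℚ ≤_) value (⟨⟩-nonNeg (λ k → v k + - 1ℚ * f k)))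
    where
    v f : Fin N → ℚ
    v = potential G conn i j
    f k = x * δ i k + (- y) * δ j k
    A B c : ℚ
    A = fromℕ (degree G i)
    B = fromℕ (degree G j)
    c = adj G i j
    pair : ∀ p q u → ⟨ (λ k → p * δ i k + q * δ j k) , u ⟩ ≡ p * outflow G u i + q * outflow G u j
    pair p q u = begin
      ⟨ (λ k → p * δ i k + q * δ j k) , u ⟩
        ≡⟨ ⟨⟩-linearˡ q (λ k → p * δ i k) (δ j) u ⟩
      ⟨ (λ k → p * δ i k) , u ⟩ + q * ⟨ δ j , u ⟩
        ≡⟨ cong₂ (λ z w → z + q * w)
             (trans (sum-cong-≗ {N} λ k → *-assoc p (δ i k) (outflow G u k))
                    (sym (*-distribˡ-sum p (λ k → δ i k * outflow G u k))))
             (∑-δ j (outflow G u)) ⟩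
      p * ⟨ δ i , u ⟩ + q * outflow G u j
        ≡⟨ cong (λ z → p * z + q * outflow G u j) (∑-δ i (outflow G u)) ⟩
      p * outflow G u i + q * outflow G u j ∎
    -- By Kirchhoff's law, pairing with `v` reads off a voltage: the resistance for `u = v`, and
    -- `x + y` for `u = f`.
    ⟨·,v⟩ : ∀ u → ⟨ u , v ⟩ ≡ u i - u j
    ⟨·,v⟩ u = begin
      ⟨ u , v ⟩
        ≡⟨ sum-cong-≗ {N} (λ k → trans (cong (u k *_) (potential-isPotential G conn i j k))
             (solve 3 (λ u a b → u :* (a :- b) := a :* u :+ (:- con 1ℚ) :* (b :* u)) refl
               (u k) (δ i k) (δ j k))) ⟩
      ∑[ k < N ] (δ i k * u k + - 1ℚ * (δ j k * u k))
        ≡⟨ ∑-linear (- 1ℚ) (λ k → δ i k * u k) (λ k → δ j k * u k) ⟩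
      ∑[ k < N ] (δ i k * u k) + - 1ℚ * ∑[ k < N ] (δ j k * u k)
        ≡⟨ cong₂ (λ a b → a + - 1ℚ * b) (∑-δ i u) (∑-δ j u) ⟩
      u i + - 1ℚ * u j
        ≡⟨ solve 2 (λ a b → a :+ (:- con 1ℚ) :* b := a :- b) refl (u i) (u j) ⟩
      u i - u j ∎
    fᵢ : f i ≡ x
    fᵢ rewrite dec-true (i Fin.≟ i) refl | dec-false (j Fin.≟ i) (i≢j ∘ sym) =
      solve 2 (λ x y → x :* con 1ℚ :+ (:- y) :* con 0ℚ := x) refl x y
    fⱼ : f j ≡ - y
    fⱼ rewrite dec-false (i Fin.≟ j) i≢j | dec-true (j Fin.≟ j) refl =
      solve 2 (λ x y → x :* con 0ℚ :+ (:- y) :* con 1ℚ := :- y) refl x y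
    outflowⱼ : outflow G f j ≡ - (x * c + y * B)
    outflowⱼ = begin
      outflow G f j
        -- Seen from `j`, `f` is again a dipole, with `- y` at `j` and minus `- x` at `i`, so
        -- `outflow-dipole` applies with the vertices exchanged.
        ≡⟨ outflow-cong (λ k → solve 4 (λ x y p q → x :* p :+ (:- y) :* q := (:- y) :* q :+ (:- (:- x)) :* p)
             refl x y (δ i k) (δ j k)) j ⟩
      outflow G (λ k → (- y) * δ j k + (- (- x)) * δ i k) j
        ≡⟨ outflow-dipole (- y) (- x) (i≢j ∘ sym) ⟩
      (- y) * B + (- x) * adj G j i
        ≡⟨ cong (λ z → (- y) * B + (- x) * z) (adj-sym G j i) ⟩
      (- y) * B + (- x) * c
        ≡⟨ solve 4 (λ x y B c → (:- y) :* B :+ (:- x) :* c := :- (x :* c :+ y :* B)) refl x y B c ⟩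
      - (x * c + y * B) ∎
      where
      outflow-cong : ∀ {u w} → (∀ k → u k ≡ w k) → ∀ k → outflow G u k ≡ outflow G w k
      outflow-cong u≡w k = sum-cong-≗ {N} λ l →
        cong₂ (λ a b → if does (k ~? l) then a - b else 0ℚ) (u≡w k) (u≡w l)
    value : ⟨ (λ k → v k + - 1ℚ * f k) , (λ k → v k + - 1ℚ * f k) ⟩ ≡
            resistance G conn i j - dualValue c A B x y
    value = begin
      ⟨ (λ k → v k + - 1ℚ * f k) , (λ k → v k + - 1ℚ * f k) ⟩
        ≡⟨ ⟨⟩-linearʳ (- 1ℚ) v f (λ k → v k + - 1ℚ * f k) ⟩
      ⟨ (λ k → v k + - 1ℚ * f k) , v ⟩ + - 1ℚ * ⟨ (λ k → v k + - 1ℚ * f k) , f ⟩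
        ≡⟨ cong₂ (λ p q → p + - 1ℚ * q) (⟨⟩-linearˡ (- 1ℚ) v f v) (⟨⟩-linearˡ (- 1ℚ) v f f) ⟩
      (⟨ v , v ⟩ + - 1ℚ * ⟨ f , v ⟩) + - 1ℚ * (⟨ v , f ⟩ + - 1ℚ * ⟨ f , f ⟩)
        ≡⟨ cong₂ (λ p q → (⟨ v , v ⟩ + - 1ℚ * ⟨ f , v ⟩) + - 1ℚ * (p + - 1ℚ * q))
             (⟨⟩-sym v f) (pair x (- y) f) ⟩
      (⟨ v , v ⟩ + - 1ℚ * ⟨ f , v ⟩) + - 1ℚ * (⟨ f , v ⟩ + - 1ℚ * (x * outflow G f i + (- y) * outflow G f j))
        ≡⟨ cong₂ (λ p q → (p + - 1ℚ * q) + - 1ℚ * (q + - 1ℚ * (x * outflow G f i + (- y) * outflow G f j)))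
             (⟨·,v⟩ v) (trans (⟨·,v⟩ f) (cong₂ _-_ fᵢ fⱼ)) ⟩
      (resistance G conn i j + - 1ℚ * (x - - y)) +
        - 1ℚ * ((x - - y) + - 1ℚ * (x * outflow G f i + (- y) * outflow G f j))
        ≡⟨ cong₂ (λ p q → (resistance G conn i j + - 1ℚ * (x - - y)) +
               - 1ℚ * ((x - - y) + - 1ℚ * (x * p + (- y) * q)))
             (outflow-dipole x y i≢j) outflowⱼ ⟩
      (resistance G conn i j + - 1ℚ * (x - - y)) +
        - 1ℚ * ((x - - y) + - 1ℚ * (x * (x * A + y * c) + (- y) * - (x * c + y * B)))
        ≡⟨ solve 6 (λ r x y A B c →
             (r :+ (:- con 1ℚ) :* (x :- :- y)) :+
               (:- con 1ℚ) :* ((x :- :- y) :+ (:- con 1ℚ) :*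
                 (x :* (x :* A :+ y :* c) :+ (:- y) :* (:- (x :* c :+ y :* B)))) :=
             r :- ((x :+ y) :+ (x :+ y) :- (x :* (x :* A :+ y :* c) :+ y :* (x :* c :+ y :* B))))
             refl (resistance G conn i j) x y A B c ⟩
      resistance G conn i j - dualValue c A B x y ∎

-- Values of the test potentials at adjacent and non-adjacent pairs.

module _ {m a b} (m≤a : m ℕ.≤ a) (a≤b : a ℕ.≤ b) (0<a : 0 ℕ.< a) where
  private
    A B M rᴬ rᴮ w wᴹ : ℚ
    A  = fromℕ a
    B  = fromℕ b
    M  = fromℕ m
    rᴬ = recip a
    rᴮ = recip b
    w  = recip (suc b)
    wᴹ = recip (suc m)

    rᴬA≡1 : rᴬ * A ≡ 1ℚ
    rᴬA≡1 = recip-inverse′ 0<a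
    rᴮB≡1 : rᴮ * B ≡ 1ℚ
    rᴮB≡1 = recip-inverse′ (ℕ.≤-trans 0<a a≤b)
    recip-suc : ∀ n → recip (suc n) * (1ℚ + fromℕ n) ≡ 1ℚ
    recip-suc n = trans (cong (recip (suc n) *_) (sym (fromℕ-homo-+ 1 n))) (recip-inverse n)

    -- The difference is `(B - A) / (A * B)`.
    recip-anti : 0ℚ ≤ rᴬ - rᴮ
    recip-anti = subst (0ℚ ≤_) eq
      (0≤* (0≤* (recip-nonNeg a) (recip-nonNeg b)) (p≤q⇒0≤q-p (fromℕ-mono a≤b)))
      where
      open ≡-Reasoning
      eq : rᴬ * rᴮ * (B - A) ≡ rᴬ - rᴮ
      eq = begin
        rᴬ * rᴮ * (B - A)
          ≡⟨ solve 4 (λ p q A B → p :* q :* (B :- A) := p :* (q :* B) :- q :* (p :* A)) refl rᴬ rᴮ A B ⟩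
        rᴬ * (rᴮ * B) - rᴮ * (rᴬ * A)
          ≡⟨ cong₂ (λ x y → rᴬ * x - rᴮ * y) rᴮB≡1 rᴬA≡1 ⟩
        rᴬ * 1ℚ - rᴮ * 1ℚ
          ≡⟨ cong₂ _-_ (*-identityʳ rᴬ) (*-identityʳ rᴮ) ⟩
        rᴬ - rᴮ ∎

    -- Up to a positive factor this is
    -- 2 A (1 + B) - (A + B) (1 + M) = (B - A) (A - 1) + (A + B) (A - M).
    leading-term : 0ℚ ≤ (wᴹ + wᴹ) - (A + B) * rᴬ * w
    leading-term = subst (0ℚ ≤_) eq
      (0≤* (0≤* (recip-nonNeg (suc m)) (0≤* (recip-nonNeg a) (recip-nonNeg (suc b))))
        -- Here `0<a` is read as `1 ≤ a`, which gives `0 ≤ A - 1`.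
        (0≤+ (0≤* (p≤q⇒0≤q-p (fromℕ-mono a≤b)) (p≤q⇒0≤q-p (fromℕ-mono 0<a)))
             (0≤* (0≤+ (fromℕ-nonNeg a) (fromℕ-nonNeg b)) (p≤q⇒0≤q-p (fromℕ-mono m≤a)))))
      where
      open ≡-Reasoning
      eq : wᴹ * (rᴬ * w) * ((B - A) * (A - 1ℚ) + (A + B) * (A - M)) ≡
           (wᴹ + wᴹ) - (A + B) * rᴬ * w
      eq = begin
        wᴹ * (rᴬ * w) * ((B - A) * (A - 1ℚ) + (A + B) * (A - M))
          ≡⟨ solve 6 (λ v r w A B M →
               v :* (r :* w) :* ((B :- A) :* (A :- con 1ℚ) :+ (A :+ B) :* (A :- M)) :=
               (v :+ v) :* ((r :* A) :* (w :* (con 1ℚ :+ B))) :-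
                 (A :+ B) :* r :* w :* (v :* (con 1ℚ :+ M))) refl wᴹ rᴬ w A B M ⟩
        (wᴹ + wᴹ) * ((rᴬ * A) * (w * (1ℚ + B))) - (A + B) * rᴬ * w * (wᴹ * (1ℚ + M))
          ≡⟨ cong₂ (λ x y → (wᴹ + wᴹ) * x - (A + B) * rᴬ * w * y)
               (cong₂ _*_ rᴬA≡1 (recip-suc b)) (recip-suc m) ⟩
        (wᴹ + wᴹ) * (1ℚ * 1ℚ) - (A + B) * rᴬ * w * 1ℚ
          ≡⟨ cong₂ _-_ (*-identityʳ (wᴹ + wᴹ)) (*-identityʳ ((A + B) * rᴬ * w)) ⟩
        (wᴹ + wᴹ) - (A + B) * rᴬ * w ∎

    -- With `y = w` the terms in `x` are `2 x (1 - w) - A x²`, with maximum `(1 - w)² / A` at the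
    -- chosen `x`. The others are `2 w - B w²`, which is `w + w²` because `w (1 + B) = 1`.
    value : dualValue 1ℚ A B ((1ℚ - w) * rᴬ) w ≡ rᴬ * ((1ℚ - w) * (1ℚ - w)) + w + w * w
    value = begin
      dualValue 1ℚ A B ((1ℚ - w) * rᴬ) w
        ≡⟨ solve 4 (λ r w A B → let x = (con 1ℚ :- w) :* r in
             (x :+ w) :+ (x :+ w) :- (x :* (x :* A :+ w :* con 1ℚ) :+ w :* (x :* con 1ℚ :+ w :* B)) :=
             (x :+ w) :+ (x :+ w) :-
               ((con 1ℚ :- w) :* x :* (r :* A) :+ x :* w :+ (x :* w :+ w :* (w :* (con 1ℚ :+ B)) :- w :* w)))
             refl rᴬ w A B ⟩
      (x + w) + (x + w) - ((1ℚ - w) * x * (rᴬ * A) + x * w + (x * w + w * (w * (1ℚ + B)) - w * w))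
        ≡⟨ cong₂ (λ p q → (x + w) + (x + w) - ((1ℚ - w) * x * p + x * w + (x * w + w * q - w * w)))
             rᴬA≡1 (recip-suc b) ⟩
      (x + w) + (x + w) - ((1ℚ - w) * x * 1ℚ + x * w + (x * w + w * 1ℚ - w * w))
        ≡⟨ solve 2 (λ r w → let x = (con 1ℚ :- w) :* r in
             (x :+ w) :+ (x :+ w) :-
               ((con 1ℚ :- w) :* x :* con 1ℚ :+ x :* w :+ (x :* w :+ w :* con 1ℚ :- w :* w)) :=
             r :* ((con 1ℚ :- w) :* (con 1ℚ :- w)) :+ w :+ w :* w) refl rᴬ w ⟩
      rᴬ * ((1ℚ - w) * (1ℚ - w)) + w + w * w ∎
      where
      open ≡-Reasoning
      x : ℚ
      x = (1ℚ - w) * rᴬ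

    -- Two steps of 1/b = 1/(b+1) + 1/(b(b+1)).
    recip-expand : rᴮ ≡ w + w * w + rᴮ * (w * w)
    recip-expand = begin
      rᴮ                     ≡⟨ step rᴮ ⟨
      w * S + w * rᴮ         ≡⟨ cong (λ z → w * S + w * z) (step rᴮ) ⟨
      w * S + w * (w * S + w * rᴮ)
        ≡⟨ cong (λ z → w * z + w * (w * z + w * rᴮ)) rᴮB≡1 ⟩
      w * 1ℚ + w * (w * 1ℚ + w * rᴮ)
        ≡⟨ solve 2 (λ w r → w :* con 1ℚ :+ w :* (w :* con 1ℚ :+ w :* r) := w :+ w :* w :+ r :* (w :* w))
             refl w rᴮ ⟩
      w + w * w + rᴮ * (w * w) ∎
      where
      open ≡-Reasoning
      S : ℚ
      S = rᴮ * B
      step : ∀ r → w * (r * B) + w * r ≡ r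
      step r = trans
        (solve 3 (λ w r B → w :* (r :* B) :+ w :* r := r :* (w :* (con 1ℚ :+ B))) refl w r B)
        (trans (cong (r *_) (recip-suc b)) (*-identityʳ r))

  -- Given y = 1/(1+b), the choice x = (1-y)/a is optimal; unlike the jointly
  -- optimal (b-1)/(ab-1), (a-1)/(ab-1) it needs no special case at a = b = 1.
  edge-bound : (A + B) * (rᴬ + rᴮ) + (- (wᴹ + wᴹ + (wᴹ + wᴹ))) * 1ℚ ≤
               (A + B) * dualValue 1ℚ A B ((1ℚ - w) * rᴬ) w
  edge-bound = 0≤q-p⇒p≤q (subst (0ℚ ≤_) eq
    -- Once `rᴮ` is expanded, `w + w * w` cancels, and the difference of the two sides is twice the
    -- leading term plus `(A + B) w² (rᴬ - rᴮ)`.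
    (0≤+ (0≤+ leading-term leading-term)
         (0≤* (0≤* (0≤+ (fromℕ-nonNeg a) (fromℕ-nonNeg b)) (square-nonNeg w)) recip-anti)))
    where
    open ≡-Reasoning
    t : ℚ
    t = (wᴹ + wᴹ) - (A + B) * rᴬ * w
    eq : t + t + (A + B) * (w * w) * (rᴬ - rᴮ) ≡
         (A + B) * dualValue 1ℚ A B ((1ℚ - w) * rᴬ) w -
           ((A + B) * (rᴬ + rᴮ) + (- (wᴹ + wᴹ + (wᴹ + wᴹ))) * 1ℚ)
    eq = begin
      t + t + (A + B) * (w * w) * (rᴬ - rᴮ)
        ≡⟨ solve 5 (λ s p q w v →
             let t = (v :+ v) :- s :* p :* w in
             t :+ t :+ s :* (w :* w) :* (p :- q) :=
             s :* (p :* ((con 1ℚ :- w) :* (con 1ℚ :- w)) :+ w :+ w :* w) :-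
               (s :* (p :+ (w :+ w :* w :+ q :* (w :* w))) :+ (:- (v :+ v :+ (v :+ v))) :* con 1ℚ))
             refl (A + B) rᴬ rᴮ w wᴹ ⟩
      (A + B) * (rᴬ * ((1ℚ - w) * (1ℚ - w)) + w + w * w) -
        ((A + B) * (rᴬ + (w + w * w + rᴮ * (w * w))) + (- (wᴹ + wᴹ + (wᴹ + wᴹ))) * 1ℚ)
        ≡⟨ cong₂ (λ p q → (A + B) * p - ((A + B) * (rᴬ + q) + (- (wᴹ + wᴹ + (wᴹ + wᴹ))) * 1ℚ))
             value recip-expand ⟨
      (A + B) * dualValue 1ℚ A B ((1ℚ - w) * rᴬ) w -
        ((A + B) * (rᴬ + rᴮ) + (- (wᴹ + wᴹ + (wᴹ + wᴹ))) * 1ℚ) ∎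

-- Without an edge the form splits into `2 p - A p²` and `2 q - B q²`, which are maximal at the
-- reciprocals of `A` and `B`, with these reciprocals as values.
dualValue-recip : ∀ {a b} → 0 ℕ.< a → 0 ℕ.< b →
                  dualValue 0ℚ (fromℕ a) (fromℕ b) (recip a) (recip b) ≡ recip a + recip b
dualValue-recip {a} {b} 0<a 0<b = begin
  dualValue 0ℚ A B p q
    ≡⟨ solve 4 (λ p q A B →
         (p :+ q) :+ (p :+ q) :- (p :* (p :* A :+ q :* con 0ℚ) :+ q :* (p :* con 0ℚ :+ q :* B)) :=
         (p :+ q) :+ (p :+ q) :- (p :* (p :* A) :+ q :* (q :* B))) refl p q A B ⟩
  (p + q) + (p + q) - (p * (p * A) + q * (q * B))
    ≡⟨ cong₂ (λ x y → (p + q) + (p + q) - (p * x + q * y)) (recip-inverse′ 0<a) (recip-inverse′ 0<b) ⟩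
  (p + q) + (p + q) - (p * 1ℚ + q * 1ℚ)
    ≡⟨ solve 2 (λ p q → (p :+ q) :+ (p :+ q) :- (p :* con 1ℚ :+ q :* con 1ℚ) := p :+ q) refl p q ⟩
  p + q ∎
  where
  open ≡-Reasoning
  A B p q : ℚ
  A = fromℕ a
  B = fromℕ b
  p = recip a
  q = recip b

-- Summation over all pairs of vertices and the final bound.

other : ∀ {N} → 1 ℕ.< N → (i : Fin N) → ∃ λ j → i ≢ j
other {suc zero} (ℕ.s<s ())
other {suc (suc _)} _ Fin.zero    = Fin.suc Fin.zero , λ ()
other {suc (suc _)} _ (Fin.suc _) = Fin.zero , λ ()

module _ {N} (G : Graph N) (conn : Connected G) (1<N : 1 ℕ.< N)
         {m} (m≤degree : ∀ i → m ℕ.≤ degree G i) where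
  open Graph G

  private
    D r : Fin N → ℚ
    D i = fromℕ (degree G i)
    r i = recip (degree G i)
    κ e : ℚ
    -- The loss `4 / (1 + m)` per edge, bracketed as in `edge-bound`.
    κ = recip (suc m) + recip (suc m) + (recip (suc m) + recip (suc m))
    e = fromℕ (2 ℕ.* edgeCount G)
    0<degree : ∀ i → 0 ℕ.< degree G i
    0<degree i = degree>0 G conn (proj₂ (other 1<N i))

  -- Reciprocal degrees are the test values for a non-adjacent pair; for an edge `edge-bound`
  -- supplies them, after `dualValue-swap` if `j` has the smaller degree. The coefficient
  -- `adj G i j` merges both cases, so that the losses sum to `κ` times the number of edges.
  pair-bound : ∀ {i j} → i ≢ j →
    (D i + D j) * (r i + r j) + (- κ) * adj G i j ≤ fromℕ (degree G i ℕ.+ degree G j) * resistance G conn i j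
  pair-bound {i} {j} i≢j = subst (λ s → (D i + D j) * (r i + r j) + (- κ) * adj G i j ≤ s * resistance G conn i j)
    (sym (fromℕ-homo-+ (degree G i) (degree G j))) (by-cases (i ~? j) (ℕ.≤-total (degree G i) (degree G j)))
    where
    open ≤-Reasoning
    scaled : ∀ x y → (D i + D j) * dualValue (adj G i j) (D i) (D j) x y ≤ (D i + D j) * resistance G conn i j
    scaled x y = *-monoˡ-≤-nonNeg (D i + D j)
      {{nonNegative (0≤+ (fromℕ-nonNeg (degree G i)) (fromℕ-nonNeg (degree G j)))}}
      (resistance-lower G conn i≢j x y)
    by-cases : Dec (i ~ j) → degree G i ℕ.≤ degree G j ⊎ degree G j ℕ.≤ degree G i →
               (D i + D j) * (r i + r j) + (- κ) * adj G i j ≤ (D i + D j) * resistance G conn i j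
    by-cases (no i≁j) _ = begin
      (D i + D j) * (r i + r j) + (- κ) * adj G i j
        ≡⟨ cong (λ c → (D i + D j) * (r i + r j) + (- κ) * c) adj≡0 ⟩
      (D i + D j) * (r i + r j) + (- κ) * 0ℚ
        ≡⟨ solve 2 (λ x k → x :+ (:- k) :* con 0ℚ := x) refl ((D i + D j) * (r i + r j)) κ ⟩
      (D i + D j) * (r i + r j)
        ≡⟨ cong ((D i + D j) *_) (dualValue-recip (0<degree i) (0<degree j)) ⟨
      (D i + D j) * dualValue 0ℚ (D i) (D j) (r i) (r j)
        ≡⟨ cong (λ c → (D i + D j) * dualValue c (D i) (D j) (r i) (r j)) adj≡0 ⟨
      (D i + D j) * dualValue (adj G i j) (D i) (D j) (r i) (r j)
        ≤⟨ scaled (r i) (r j) ⟩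
      (D i + D j) * resistance G conn i j ∎
      where
      adj≡0 : adj G i j ≡ 0ℚ
      adj≡0 = cong (λ p → if p then 1ℚ else 0ℚ) (dec-false (i ~? j) i≁j)
    by-cases (yes i~j) (inj₁ dᵢ≤dⱼ) = begin
      (D i + D j) * (r i + r j) + (- κ) * adj G i j
        ≡⟨ cong (λ c → (D i + D j) * (r i + r j) + (- κ) * c) (adj-~ G i~j) ⟩
      (D i + D j) * (r i + r j) + (- κ) * 1ℚ
        ≤⟨ edge-bound (m≤degree i) dᵢ≤dⱼ (0<degree i) ⟩
      (D i + D j) * dualValue 1ℚ (D i) (D j) x w
        ≡⟨ cong (λ c → (D i + D j) * dualValue c (D i) (D j) x w) (adj-~ G i~j) ⟨
      (D i + D j) * dualValue (adj G i j) (D i) (D j) x w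
        ≤⟨ scaled x w ⟩
      (D i + D j) * resistance G conn i j ∎
      where
      w x : ℚ
      w = recip (suc (degree G j))
      x = (1ℚ - w) * r i
    by-cases (yes i~j) (inj₂ dⱼ≤dᵢ) = begin
      (D i + D j) * (r i + r j) + (- κ) * adj G i j
        ≡⟨ cong₂ (λ c z → z + (- κ) * c) (adj-~ G i~j)
             (cong₂ _*_ (+-comm (D i) (D j)) (+-comm (r i) (r j))) ⟩
      (D j + D i) * (r j + r i) + (- κ) * 1ℚ
        ≤⟨ edge-bound (m≤degree j) dⱼ≤dᵢ (0<degree j) ⟩
      (D j + D i) * dualValue 1ℚ (D j) (D i) x w
        ≡⟨ cong₂ _*_ (+-comm (D j) (D i)) (dualValue-swap 1ℚ (D j) (D i) x w) ⟩
      (D i + D j) * dualValue 1ℚ (D i) (D j) w x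
        ≡⟨ cong (λ c → (D i + D j) * dualValue c (D i) (D j) w x) (adj-~ G i~j) ⟨
      (D i + D j) * dualValue (adj G i j) (D i) (D j) w x
        ≤⟨ scaled w x ⟩
      (D i + D j) * resistance G conn i j ∎
      where
      w x : ℚ
      w = recip (suc (degree G i))
      x = (1ℚ - w) * r j

  -- The summand is `a i j + a j i` for `a i j = D i * (r i + r j) = 1 + D i * r
  -- j`. Over all ordered pairs `a` sums to `N² + e * sum r` by `handshake`, and its diagonal
  -- entries are 2, which removes `2 N`.
  ∑<-degree-recip : ∑< (λ i j → (D i + D j) * (r i + r j)) ≡
                    fromℕ N * (fromℕ N - fromℕ 2) + e * sum r
  ∑<-degree-recip = begin
    ∑< (λ i j → (D i + D j) * (r i + r j))
      ≡⟨ ∑<-cong (λ i j → solve 4 (λ a b p q → (a :+ b) :* (p :+ q) := a :* (p :+ q) :+ b :* (q :+ p))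
           refl (D i) (D j) (r i) (r j)) ⟩
    ∑< (λ i j → a i j + a j i)
      ≡⟨ solve 2 (λ x y → x := (x :+ y) :- y) refl (∑< (λ i j → a i j + a j i)) (∑[ i < N ] a i i) ⟩
    (∑< (λ i j → a i j + a j i) + ∑[ i < N ] a i i) - ∑[ i < N ] a i i
      ≡⟨ cong₂ _-_ (sym (∑∑-split a)) diagonal ⟩
    ∑[ i < N ] ∑[ j < N ] a i j - fromℕ N * fromℕ 2
      ≡⟨ cong (_- fromℕ N * fromℕ 2) total ⟩
    fromℕ N * (fromℕ N * 1ℚ) + sum r * e - fromℕ N * fromℕ 2
      ≡⟨ solve 4 (λ n t s e → n :* (n :* con 1ℚ) :+ s :* e :- n :* t := n :* (n :- t) :+ e :* s)
           refl (fromℕ N) (fromℕ 2) (sum r) e ⟩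
    fromℕ N * (fromℕ N - fromℕ 2) + e * sum r ∎
    where
    open ≡-Reasoning
    a : Fin N → Fin N → ℚ
    a i j = D i * (r i + r j)
    a≡ : ∀ i j → a i j ≡ 1ℚ + D i * r j
    a≡ i j = trans
      (solve 3 (λ d p q → d :* (p :+ q) := p :* d :+ d :* q) refl (D i) (r i) (r j))
      (cong (_+ D i * r j) (recip-inverse′ (0<degree i)))
    diagonal : ∑[ i < N ] a i i ≡ fromℕ N * fromℕ 2
    diagonal = trans
      (sum-cong-≗ {N} λ i → trans (a≡ i i)
        (cong (λ z → 1ℚ + z) (trans (*-comm (D i) (r i)) (recip-inverse′ (0<degree i)))))
      (∑-const N (1ℚ + 1ℚ))
    total : ∑[ i < N ] ∑[ j < N ] a i j ≡ fromℕ N * (fromℕ N * 1ℚ) + sum r * e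
    total = begin
      ∑[ i < N ] ∑[ j < N ] a i j
        ≡⟨ sum-cong-≗ {N} (λ i → trans (sum-cong-≗ {N} (a≡ i)) (trans
             (∑-linear (D i) (λ _ → 1ℚ) r)
             (cong₂ _+_ (∑-const N 1ℚ) (*-comm (D i) (sum r))))) ⟩
      ∑[ i < N ] (fromℕ N * 1ℚ + sum r * D i)
        ≡⟨ ∑-linear (sum r) (λ _ → fromℕ N * 1ℚ) D ⟩
      ∑[ i < N ] (fromℕ N * 1ℚ) + sum r * sum D
        ≡⟨ cong₂ (λ x y → x + sum r * y) (∑-const N (fromℕ N * 1ℚ)) (handshake G) ⟩
      fromℕ N * (fromℕ N * 1ℚ) + sum r * e ∎

  -- Sums `pair-bound` over all pairs. Degrees are taken in vertex order and `m` is any lower bound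
  -- for them, which keeps the sorting out of the estimate.
  R⁺-lower : fromℕ N * (fromℕ N - fromℕ 2) + e * sum r - (+ (4 ℕ.* edgeCount G)) / suc m ≤ R⁺ G conn
  R⁺-lower = begin
    fromℕ N * (fromℕ N - fromℕ 2) + e * sum r - (+ (4 ℕ.* edgeCount G)) / suc m
      ≡⟨ cong₂ _-_ (sym ∑<-degree-recip) correction ⟩
    ∑< (λ i j → (D i + D j) * (r i + r j)) - κ * ∑< (adj G)
      ≡⟨ solve 3 (λ x k y → x :- k :* y := x :+ (:- k) :* y) refl
           (∑< (λ i j → (D i + D j) * (r i + r j))) κ (∑< (adj G)) ⟩
    ∑< (λ i j → (D i + D j) * (r i + r j)) + (- κ) * ∑< (adj G)
      ≡⟨ ∑<-linear (- κ) (λ i j → (D i + D j) * (r i + r j)) (adj G) ⟨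
    ∑< (λ i j → (D i + D j) * (r i + r j) + (- κ) * adj G i j)
      ≤⟨ ∑<-mono (λ i<j → pair-bound (Fin.<⇒≢ i<j)) ⟩
    R⁺ G conn ∎
    where
    open ≤-Reasoning
    correction : (+ (4 ℕ.* edgeCount G)) / suc m ≡ κ * ∑< (adj G)
    correction = begin-equality
      (+ (4 ℕ.* edgeCount G)) / suc m
        ≡⟨ /≡fromℕ*recip (4 ℕ.* edgeCount G) m ⟩
      fromℕ (4 ℕ.* edgeCount G) * recip (suc m)
        ≡⟨ cong (_* recip (suc m)) (fromℕ-homo-* 4 (edgeCount G)) ⟩
      fromℕ 4 * fromℕ (edgeCount G) * recip (suc m)
        ≡⟨ solve 2 (λ x y → con (fromℕ 4) :* x :* y := (y :+ y :+ (y :+ y)) :* x) refl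
             (fromℕ (edgeCount G)) (recip (suc m)) ⟩
      κ * fromℕ (edgeCount G)
        ≡⟨ cong (κ *_) (fromℕ-edgeCount G) ⟩
      κ * ∑< (adj G) ∎

theorem3 : (N : ℕ) (N>2 : N ℕ.> 2) (G : Graph N) (conn : Connected G)
    (d : Fin N → ℕ) → IsDegreeSequence G d →
    R⁺ G conn ≥
    fromℕ N * (fromℕ N - fromℕ 2)
    + fromℕ (2 ℕ.* edgeCount G) * (∑[ j < N ] recip (d j))
    - (+ (4 ℕ.* edgeCount G)) / (1 ℕ.+ d (fromℕ< (ℕ.<-trans z<s N>2)))
theorem3 N N>2 G conn d (d-mono , π , d≡degree) =
  subst (λ s → fromℕ N * (fromℕ N - fromℕ 2) + fromℕ (2 ℕ.* edgeCount G) * s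
               - (+ (4 ℕ.* edgeCount G)) / suc (d first) ≤ R⁺ G conn)
    (sym ∑-recip) (R⁺-lower G conn (ℕ.<-trans ℕ.≤-refl N>2) first-minimal)
  where
  first : Fin N
  first = fromℕ< (ℕ.<-trans z<s N>2)
  -- Sorting the degrees only permutes the summands.
  ∑-recip : ∑[ j < N ] recip (d j) ≡ ∑[ j < N ] recip (degree G j)
  ∑-recip = trans (sum-cong-≗ {N} (cong recip ∘ d≡degree))
    (sym (sum-permute (λ j → recip (degree G j)) π))
  first-minimal : ∀ i → d first ℕ.≤ degree G i
  -- Vertex `i` sits at position `π ⟨$⟩ˡ i` of the sorted sequence, and `first` is position 0.
  first-minimal i = subst (d first ℕ.≤_)
    (trans (d≡degree (π ⟨$⟩ˡ i)) (cong (degree G) (inverseʳ π)))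
    (d-mono (subst (ℕ._≤ Fin.toℕ (π ⟨$⟩ˡ i)) (sym (Fin.toℕ-fromℕ< (ℕ.<-trans z<s N>2))) z≤n))
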